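{- The tournament $P_7$ does not have the strong EH-property.
   Context: A tournament is a finite loopless digraph such that for every pair $u,v$ of distinct vertices exactly one of $uv,vu$ is an edge; an edge $uv$ is directed from $u$ to $v$. A tournament $G$ is $H$-free if no subtournament of $G$ is isomorphic to $H$. $|G|$ denotes the number of vertices. A pure pair in a tournament $G$ is an ordered pair $(A,B)$ of disjoint subsets of $V(G)$ such that $ab\in E(G)$ for all $a\in A,b\in B$; its order is $\min(|A|,|B|)$. A tournament $H$ has the strong EH-property if there exists $c>0$ such that for every $H$-free tournament $G$ with $|G|>1$, there is a pure pair in $G$ of order at least $c|G|$. $P_7$ is the Paley tournament with vertex set $\{1,\dots,7\}$ in which, for distinct $i,j$, there is an edge from $i$ to $j$ if and only if $j-i$ is congruent to $1$, $2$ or $4$ modulo $7$. -}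

module Defs where

open import Level using (0ℓ)
open import Data.Nat.Base using (ℕ; _⊓_; _<_)
open import Data.Integer.Base as ℤ using (ℤ; +_; 1ℤ)
import Data.Integer.Divisibility.Signed as ℤ
open import Data.Rational.Base as ℚ using (ℚ; 0ℚ)
open import Data.Fin.Base using (Fin; toℕ)
open import Data.Fin.Properties using (_≟_; all?)
open import Data.Fin.Subset using (Subset; _∈_; _∩_; ∣_∣; Empty)
open import Data.Product.Base using (Σ-syntax; ∃; _×_; proj₁)
open import Data.Sum.Base using (_⊎_)
open import Function.Base using (_on_)
open import Function.Bundles using (_↔_; _⇔_; Inverse)
open import Relation.Binary.Core using (Rel)
open import Relation.Binary.Definitions using (Decidable)
open import Relation.Binary.PropositionalEquality.Core using (_≢_)
open import Relation.Nullary.Decidable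
  using (¬?; _×-dec_; _⊎-dec_; _→-dec_; from-yes)
open import Relation.Nullary.Negation.Core using (¬_)

record Tournament : Set₁ where
  field
    order    : ℕ
    Edge     : Rel (Fin order) 0ℓ
    loopless : ∀ u → ¬ Edge u u
    exactly-one : ∀ u v → u ≢ v →
      (Edge u v × ¬ Edge v u) ⊎ (¬ Edge u v × Edge v u)

  Vertex : Set
  Vertex = Fin order

open Tournament public using (order; Vertex; Edge)

-- Isomorphism of digraphs, each given by a vertex type and an edge relation.
Isomorphic : {V W : Set} → Rel V 0ℓ → Rel W 0ℓ → Set
Isomorphic {V} {W} E F =
  Σ[ φ ∈ V ↔ W ] (∀ u v → E u v ⇔ F (Inverse.to φ u) (Inverse.to φ v))

InducedEdge : (G : Tournament) (S : Subset (order G)) → Rel (∃ (_∈ S)) 0ℓ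
InducedEdge G S = Edge G on proj₁

_-Free_ : Tournament → Tournament → Set
H -Free G = ∀ (S : Subset (order G)) → ¬ Isomorphic (Edge H) (InducedEdge G S)

record PurePair (G : Tournament) : Set where
  field
    A B      : Subset (order G)
    disjoint : Empty (A ∩ B)
    complete : ∀ {a b} → a ∈ A → b ∈ B → Edge G a b

  pairOrder : ℕ
  pairOrder = ∣ A ∣ ⊓ ∣ B ∣

fromℕ : ℕ → ℚ
fromℕ n = + n ℚ./ 1

-- The constant c ranges over the positive rationals; this is equivalent to
-- letting it range over the positive reals, since a smaller c also works.
StrongEH : Tournament → Set₁
StrongEH H =
  Σ[ c ∈ ℚ ] (0ℚ ℚ.< c ×
    (∀ (G : Tournament) → H -Free G → 1 < order G →
      Σ[ P ∈ PurePair G ] c ℚ.* fromℕ (order G) ℚ.≤ fromℕ (PurePair.pairOrder P)))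

_≡_mod7 : ℤ → ℤ → Set
a ≡ b mod7 = + 7 ℤ.∣ a ℤ.- b

-- Vertex i : Fin 7 stands for the label i + 1 ∈ {1, …, 7}.
label : Fin 7 → ℤ
label i = 1ℤ ℤ.+ + toℕ i

PaleyEdge : Rel (Fin 7) 0ℓ
PaleyEdge i j = i ≢ j × (d ≡ + 1 mod7 ⊎ d ≡ + 2 mod7 ⊎ d ≡ + 4 mod7)
  where d = label j ℤ.- label i

paleyEdge? : Decidable PaleyEdge
paleyEdge? i j =
  ¬? (i ≟ j) ×-dec ((+ 7 ℤ.∣? _) ⊎-dec (+ 7 ℤ.∣? _) ⊎-dec (+ 7 ℤ.∣? _))

P₇ : Tournament
P₇ = record
  { order       = 7
  ; Edge        = PaleyEdge
  ; loopless    = from-yes (all? λ u → ¬? (paleyEdge? u u))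
  ; exactly-one = from-yes (all? λ u → all? λ v → ¬? (u ≟ v) →-dec
      ((paleyEdge? u v ×-dec ¬? (paleyEdge? v u)) ⊎-dec
       (¬? (paleyEdge? u v) ×-dec paleyEdge? v u)))
  }

{-# OPTIONS --safe #-}

-- The edges of P₇ split into seven cyclic triangles, so however a copy of P₇ is
-- placed in a linearly ordered tournament, at least seven of its edges are
-- backedges.  Choose the graph of backedges at random with edge probability 1/N
-- on n = d N vertices.  Seven vertices spanning seven prescribed edges then
-- occur boundedly often, at most (3 d)^7 times on average, whatever N is, and
-- discarding the backedges at one vertex of each occurrence makes the tournament
-- P₇-free.  A pure pair (A , B) of linear order prescribes the colours of all
-- pairs between A and B, an event of probability at most (1 - 1/N)^(|A||B|),
-- which for large d is too small to survive the union bound over 4^n pairs.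
module Submission where

open import Defs
open import Relation.Nullary.Negation.Core using (¬_; contradiction)

open import Data.Bool.Base using (Bool; true; false; if_then_else_)
import Data.Bool.Properties as Bool
open import Data.Empty using (⊥)
open import Data.Fin.Base using (Fin; zero; suc; combine; quotient)
import Data.Fin.Base as Fin
import Data.Fin.Properties as Fin
import Data.Integer.Base as ℤ
import Data.Integer.Properties as ℤ
open import Data.Rational.Base using (0ℚ)
import Data.Rational.Base as ℚ
import Data.Rational.Properties as ℚ
import Data.Rational.Unnormalised.Base as ℚᵘ
import Data.Rational.Unnormalised.Properties as ℚᵘ
open import Data.Fin.Subset using (Subset; inside; outside; ∣_∣; _∩_; Empty; _∈_)
open import Data.Fin.Subset.Properties using (x∈p∩q⁺; x∈p∩q⁻)
open import Data.List.Base
  using (List; []; _∷_; map; length; filter; take; allFin; cartesianProductWith;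
         cartesianProduct; foldr; tabulate)
open import Data.List.Properties using (length-map; length-tabulate; length-take; length-filter; length-++)
open import Data.List.Membership.Propositional using () renaming (_∈_ to _∈ˡ_; _∉_ to _∉ˡ_)
open import Data.List.Membership.Propositional.Properties
  using (∈-allFin; ∈-cartesianProductWith⁺; ∈-cartesianProduct⁺; ∈-map⁺; ∈-filter⁺)
open import Data.List.Relation.Unary.All using (All; []; _∷_)
import Data.List.Relation.Unary.All as All
import Data.List.Relation.Unary.All.Properties as All
open import Data.List.Relation.Unary.AllPairs using ([]; _∷_)
open import Data.List.Relation.Unary.Any using (here; there)
open import Data.List.Relation.Unary.Unique.Propositional using (Unique)
import Data.List.Relation.Unary.Unique.Propositional.Properties as Unique
open import Data.Nat.Base
open import Data.Nat.ListAction using (sum; product)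
open import Data.Nat.Properties
open import Data.Nat.Tactic.RingSolver using (solve-∀)
open import Data.Product.Base using (_×_; _,_; proj₁; proj₂; ∃; Σ-syntax)
open import Data.Product.Properties using (≡-dec)
open import Data.Sum.Base using (_⊎_; inj₁; inj₂; [_,_]′)
open import Data.Vec.Base using (Vec; []; _∷_; lookup; _[_]≔_)
import Data.Vec.Base as Vec
import Data.Vec.Properties as Vec
open import Function.Base using (_∘_)
open import Function.Bundles using (Inverse; Equivalence)
open import Level using (0ℓ)
open import Relation.Binary.PropositionalEquality
  using (_≡_; _≢_; refl; sym; trans; cong; cong₂; subst; subst₂; setoid; module ≡-Reasoning)
open import Relation.Nullary.Decidable
  using (Dec; yes; no; does; dec-true; dec-false; ¬?; _×-dec_; _⊎-dec_; _→-dec_; from-yes)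
open import Relation.Binary.Definitions using (tri<; tri≈; tri>)
open import Relation.Unary using (Decidable; Pred)

import Data.List.Membership.DecPropositional as DecMembership
import Data.List.Relation.Unary.Unique.DecPropositional as DecUnique

private
  variable
    I X Y : Set
    n : ℕ

-- Enumerating vectors and subsets.

vectors : List X → ∀ k → List (Vec X k)
vectors xs zero    = [] ∷ []
vectors xs (suc k) = cartesianProductWith _∷_ xs (vectors xs k)

∈-vectors : ∀ {k} {xs : List X} → (∀ x → x ∈ˡ xs) → (v : Vec X k) → v ∈ˡ vectors xs k
∈-vectors every []      = here refl
∈-vectors every (x ∷ v) = ∈-cartesianProductWith⁺ _∷_ (every x) (∈-vectors every v)

length-cartesianProductWith : ∀ {Z : Set} (f : X → Y → Z) xs ys →
  length (cartesianProductWith f xs ys) ≡ length xs * length ys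
length-cartesianProductWith f []       ys = refl
length-cartesianProductWith f (x ∷ xs) ys =
  trans (length-++ (map (f x) ys))
        (cong₂ _+_ (length-map (f x) ys) (length-cartesianProductWith f xs ys))

length-vectors : ∀ (xs : List X) k → length (vectors xs k) ≡ length xs ^ k
length-vectors xs zero    = refl
length-vectors xs (suc k) =
  trans (length-cartesianProductWith _∷_ xs (vectors xs k))
        (cong (length xs *_) (length-vectors xs k))

length-vectors² : ∀ (xs : List X) (ys : List Y) k →
  length (cartesianProduct (vectors xs k) (vectors ys k)) ≡ length xs ^ k * length ys ^ k
length-vectors² xs ys k = trans (length-cartesianProductWith _,_ (vectors xs k) (vectors ys k))
  (cong₂ _*_ (length-vectors xs k) (length-vectors ys k))

-- Injectivity is asked only on `P` because `coord` forgets the order of its arguments: it is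
-- injective on pairs taken from two disjoint sets, not on all pairs.
unique-map-on : ∀ {P : Pred X 0ℓ} {f : X → Y} → (∀ {x y} → P x → P y → f x ≡ f y → x ≡ y) →
  ∀ {xs} → All P xs → Unique xs → Unique (map f xs)
unique-map-on inj []         []           = []
unique-map-on inj (px ∷ pxs) (x∉xs ∷ uxs) =
  All.map⁺ (All.zipWith (λ { (py , x≢y) eq → x≢y (inj px py eq) }) (pxs , x∉xs))
    ∷ unique-map-on inj pxs uxs

elements : Subset n → List (Fin n)
elements []            = []
elements (outside ∷ p) = map suc (elements p)
elements (inside  ∷ p) = zero ∷ map suc (elements p)

length-elements : (p : Subset n) → length (elements p) ≡ ∣ p ∣
length-elements []            = refl
length-elements (outside ∷ p) = trans (length-map suc (elements p)) (length-elements p)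
length-elements (inside  ∷ p) = cong suc (trans (length-map suc (elements p)) (length-elements p))

elements-unique : (p : Subset n) → Unique (elements p)
elements-unique []            = []
elements-unique (outside ∷ p) = Unique.map⁺ Fin.suc-injective (elements-unique p)
elements-unique (inside  ∷ p) =
  All.map⁺ (All.universal (λ _ ()) (elements p))
    ∷ Unique.map⁺ Fin.suc-injective (elements-unique p)

elements⊆ : (p : Subset n) → All (_∈ p) (elements p)
elements⊆ []            = []
elements⊆ (outside ∷ p) = All.map⁺ (All.map Vec.there (elements⊆ p))
elements⊆ (inside  ∷ p) = Vec.here ∷ All.map⁺ (All.map Vec.there (elements⊆ p))

_∖_ : Subset n → List (Fin n) → Subset n
p ∖ xs = foldr (λ x q → q [ x ]≔ outside) p xs

∣∣-delete : (p : Subset n) (x : Fin n) → ∣ p ∣ ≤ suc ∣ p [ x ]≔ outside ∣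
∣∣-delete (outside ∷ p) zero    = n≤1+n _
∣∣-delete (inside  ∷ p) zero    = ≤-refl
∣∣-delete (outside ∷ p) (suc x) = ∣∣-delete p x
∣∣-delete (inside  ∷ p) (suc x) = s≤s (∣∣-delete p x)

∣∣-∖ : (p : Subset n) (xs : List (Fin n)) → ∣ p ∣ ≤ length xs + ∣ p ∖ xs ∣
∣∣-∖ p []       = ≤-refl
∣∣-∖ p (x ∷ xs) = ≤-trans (∣∣-∖ p xs) (≤-trans
  (+-monoʳ-≤ (length xs) (∣∣-delete (p ∖ xs) x)) (≤-reflexive (+-suc (length xs) _)))

∈-delete⁻ : (p : Subset n) (x : Fin n) {y : Fin n} → y ∈ p [ x ]≔ outside → y ∈ p × y ≢ x
∈-delete⁻ (s ∷ p) zero    (Vec.there y∈)   = Vec.there y∈ , λ ()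
∈-delete⁻ (s ∷ p) (suc x) Vec.here         = Vec.here , λ ()
∈-delete⁻ (s ∷ p) (suc x) (Vec.there y∈) with ∈-delete⁻ p x y∈
... | y∈p , y≢x = Vec.there y∈p , y≢x ∘ Fin.suc-injective

∈-∖⁻ : (p : Subset n) (xs : List (Fin n)) {y : Fin n} → y ∈ p ∖ xs → y ∈ p × y ∉ˡ xs
∈-∖⁻ p []       y∈ = y∈ , λ ()
∈-∖⁻ p (x ∷ xs) y∈ with ∈-delete⁻ (p ∖ xs) x y∈
... | y∈p∖xs , y≢x with ∈-∖⁻ p xs y∈p∖xs
... | y∈p , y∉xs = y∈p , λ { (here y≡x) → y≢x y≡x ; (there y∈xs) → y∉xs y∈xs }

∖-disjoint : ∀ {A B : Subset n} D → Empty (A ∩ B) → Empty ((A ∖ D) ∩ (B ∖ D))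
∖-disjoint {A = A} {B} D ∅ (x , x∈) with x∈p∩q⁻ (A ∖ D) (B ∖ D) x∈
... | x∈A , x∈B = ∅ (x , x∈p∩q⁺ (proj₁ (∈-∖⁻ A D x∈A) , proj₁ (∈-∖⁻ B D x∈B)))

-- Sums, and events prescribing values of a colouring.

sum-≤ : ∀ (f : I → ℕ) a b {is} → All (λ i → a * f i ≤ b) is →
  a * sum (map f is) ≤ length is * b
sum-≤ f a b []                 = ≤-reflexive (*-zeroʳ a)
sum-≤ f a b {i ∷ is} (p ∷ ps)  = ≤-trans
  (≤-reflexive (*-distribˡ-+ a (f i) (sum (map f is)))) (+-mono-≤ p (sum-≤ f a b ps))

∈⇒≤sum : ∀ (f : I → ℕ) {i is} → i ∈ˡ is → f i ≤ sum (map f is)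
∈⇒≤sum f (here refl)          = m≤m+n _ _
∈⇒≤sum f (there {x = j} i∈is) = ≤-trans (∈⇒≤sum f i∈is) (m≤n+m _ (f j))

δ : Bool → Bool → ℕ
δ a b = if does (a Bool.≟ b) then 1 else 0

δ-refl : ∀ {a b} → a ≡ b → δ a b ≡ 1
δ-refl {true}  refl = refl
δ-refl {false} refl = refl

-- An event prescribes the values β of a colouring on the coordinates in xs.
Event : ℕ → Set
Event M = List (Fin M) × (Fin M → Bool)

module _ {M : ℕ} where

  Occurs : Event M → Pred (Vec Bool M) _
  Occurs (xs , β) g = All (λ i → lookup g i ≡ β i) xs

  occurs? : ∀ e g → Dec (Occurs e g)
  occurs? (xs , β) g = All.all? (λ i → lookup g i Bool.≟ β i) xs

  -- The indicator is a product with one factor per coordinate, so that the factors can be averaged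
  -- out one at a time.
  χ : Event M → Vec Bool M → ℕ
  χ (xs , β) g = product (map (λ i → δ (lookup g i) (β i)) xs)

  occurs⇒χ≡1 : ∀ e g → Occurs e g → χ e g ≡ 1
  occurs⇒χ≡1 ([]     , β) g []       = refl
  occurs⇒χ≡1 (x ∷ xs , β) g (p ∷ ps) = cong₂ _*_ (δ-refl p) (occurs⇒χ≡1 (xs , β) g ps)

  Proper : ℕ → Pred (Event M) _
  Proper ℓ (xs , β) = Unique xs × length xs ≡ ℓ

  proper? : ∀ ℓ → Decidable (Proper ℓ)
  proper? ℓ (xs , β) = DecUnique.unique? Fin._≟_ xs ×-dec (length xs ≟ ℓ)

  count : (I → Event M) → List I → Vec Bool M → ℕ
  count ev is g = sum (map (λ i → χ (ev i) g) is)

  occurring≤count : ∀ (ev : I → Event M) is g →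
    length (filter (λ i → occurs? (ev i) g) is) ≤ count ev is g
  occurring≤count ev []       g = z≤n
  occurring≤count ev (i ∷ is) g with occurs? (ev i) g
  ... | yes p = +-mono-≤ (≤-reflexive (sym (occurs⇒χ≡1 (ev i) g p))) (occurring≤count ev is g)
  ... | no  _ = ≤-trans (occurring≤count ev is g) (m≤n+m _ _)

-- Expectation over random colourings, cleared of denominators.

-- W is (1 + r)^M times the expectation when each coordinate is independently
-- true with probability 1/(1 + r).
module Weighted (r : ℕ) where

  N : ℕ
  N = suc r

  weight : Bool → ℕ
  weight true  = 1
  weight false = r

  W : ∀ M → (Vec Bool M → ℕ) → ℕ
  W zero    F = F []
  W (suc M) F = W M (F ∘ (true ∷_)) + r * W M (F ∘ (false ∷_))

  W-mono : ∀ M {F G} → (∀ g → F g ≤ G g) → W M F ≤ W M G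
  W-mono zero    le = le []
  W-mono (suc M) le =
    +-mono-≤ (W-mono M (le ∘ (true ∷_))) (*-monoʳ-≤ r (W-mono M (le ∘ (false ∷_))))

  W-cong : ∀ M {F G} → (∀ g → F g ≡ G g) → W M F ≡ W M G
  W-cong M eq = ≤-antisym (W-mono M (≤-reflexive ∘ eq)) (W-mono M (≤-reflexive ∘ sym ∘ eq))

  W-+ : ∀ M F G → W M (λ g → F g + G g) ≡ W M F + W M G
  W-+ zero    F G = refl
  W-+ (suc M) F G = trans
    (cong₂ (λ a b → a + r * b) (W-+ M (F ∘ (true ∷_)) (G ∘ (true ∷_)))
      (W-+ M (F ∘ (false ∷_)) (G ∘ (false ∷_))))
    (shuffle r (W M (F ∘ (true ∷_))) (W M (G ∘ (true ∷_))) _ _)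
    where
    shuffle : ∀ r a b c d → (a + b) + r * (c + d) ≡ (a + r * c) + (b + r * d)
    shuffle = solve-∀

  W-* : ∀ M c F → W M (λ g → c * F g) ≡ c * W M F
  W-* zero    c F = refl
  W-* (suc M) c F = trans
    (cong₂ (λ a b → a + r * b) (W-* M c _) (W-* M c _)) (shuffle r c _ _)
    where
    shuffle : ∀ r c a b → c * a + r * (c * b) ≡ c * (a + r * b)
    shuffle = solve-∀

  W-const : ∀ M c → W M (λ _ → c) ≡ N ^ M * c
  W-const zero    c = sym (+-identityʳ c)
  W-const (suc M) c = trans (cong (λ a → a + r * a) (W-const M c)) (shuffle r (N ^ M) c)
    where
    shuffle : ∀ r a c → a * c + r * (a * c) ≡ (1 + r) * a * c
    shuffle = solve-∀

  W-sum : ∀ M (F : I → Vec Bool M → ℕ) is →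
    W M (λ g → sum (map (λ i → F i g) is)) ≡ sum (map (λ i → W M (F i)) is)
  W-sum M F []       = trans (W-const M 0) (*-zeroʳ (N ^ M))
  W-sum M F (i ∷ is) = trans (W-+ M (F i) _) (cong (W M (F i) +_) (W-sum M F is))

  -- Independence: `F` ignores coordinate `i`, so prescribing the value `b` there multiplies the
  -- expectation by `weight b / N`.
  W-δ : ∀ M (i : Fin M) b F → (∀ g c → F (g [ i ]≔ c) ≡ F g) →
    N * W M (λ g → δ (lookup g i) b * F g) ≡ weight b * W M F
  W-δ (suc M) zero true F ind = begin
    N * (W M (λ g → F (true ∷ g) + 0) + r * W M (λ _ → 0))
      ≡⟨ cong₂ (λ a b → N * (a + r * b)) (W-cong M (λ g → +-identityʳ _))
           (trans (W-const M 0) (*-zeroʳ (N ^ M))) ⟩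
    N * (W M (F ∘ (true ∷_)) + r * 0)
      ≡⟨ shuffle r _ ⟩
    1 * (W M (F ∘ (true ∷_)) + r * W M (F ∘ (true ∷_)))
      -- Both values of the first coordinate give `F` the same mean, and their weights `1` and `r`
      -- add up to `N`.
      ≡⟨ cong (λ a → 1 * (W M (F ∘ (true ∷_)) + r * a)) (W-cong M (λ g → ind (false ∷ g) true)) ⟩
    1 * W (suc M) F ∎
    where
    open ≡-Reasoning
    shuffle : ∀ r a → (1 + r) * (a + r * 0) ≡ 1 * (a + r * a)
    shuffle = solve-∀
  W-δ (suc M) zero false F ind = begin
    N * (W M (λ _ → 0) + r * W M (λ g → F (false ∷ g) + 0))
      ≡⟨ cong₂ (λ a b → N * (a + r * b)) (trans (W-const M 0) (*-zeroʳ (N ^ M)))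
           (W-cong M (λ g → +-identityʳ _)) ⟩
    N * (0 + r * W M (F ∘ (false ∷_)))
      ≡⟨ shuffle r _ ⟩
    r * (W M (F ∘ (false ∷_)) + r * W M (F ∘ (false ∷_)))
      ≡⟨ cong (λ a → r * (a + r * W M (F ∘ (false ∷_)))) (W-cong M (λ g → ind (true ∷ g) false)) ⟩
    r * W (suc M) F ∎
    where
    open ≡-Reasoning
    shuffle : ∀ r a → (1 + r) * (0 + r * a) ≡ r * (a + r * a)
    shuffle = solve-∀
  W-δ (suc M) (suc i) b F ind = begin
    N * (S true + r * S false)          ≡⟨ shuffle N r (S true) (S false) ⟩
    N * S true + r * (N * S false)      ≡⟨ cong₂ (λ x y → x + r * y) (step true) (step false) ⟩
    weight b * W M (F ∘ (true ∷_)) + r * (weight b * W M (F ∘ (false ∷_)))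
                                        ≡⟨ sym (shuffle (weight b) r _ _) ⟩
    weight b * W (suc M) F              ∎
    where
    open ≡-Reasoning
    S : Bool → ℕ
    S a = W M (λ g → δ (lookup g i) b * F (a ∷ g))
    step : ∀ a → N * S a ≡ weight b * W M (F ∘ (a ∷_))
    step a = W-δ M i b (F ∘ (a ∷_)) (λ g → ind (a ∷ g))
    shuffle : ∀ n r a b → n * (a + r * b) ≡ n * a + r * (n * b)
    shuffle = solve-∀

  χ-update : ∀ {M} xs β (i : Fin M) → All (i ≢_) xs →
    ∀ g c → χ (xs , β) (g [ i ]≔ c) ≡ χ (xs , β) g
  χ-update []       β i []         g c = refl
  χ-update (x ∷ xs) β i (i≢x ∷ ps) g c = cong₂ _*_
    (cong (λ a → δ a (β x)) (Vec.lookup∘update′ (i≢x ∘ sym) g c)) (χ-update xs β i ps g c)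

  -- Peeling off one coordinate at a time costs a factor of at most `w / N`; distinctness makes the
  -- remaining factors ignore the coordinate removed.
  W-χ : ∀ {M} w xs β → (∀ i → weight (β i) ≤ w) → Unique xs →
    N ^ length xs * W M (χ (xs , β)) ≤ w ^ length xs * N ^ M
  W-χ {M} w []       β β≤w []           =
    ≤-reflexive (cong (_+ 0) (trans (W-const M 1) (*-identityʳ _)))
  W-χ {M} w (x ∷ xs) β β≤w (x∉xs ∷ uxs) = begin
    N * N ^ ℓ * W M (χ (x ∷ xs , β))       ≡⟨ shuffle N (N ^ ℓ) _ ⟩
    N ^ ℓ * (N * W M (χ (x ∷ xs , β)))
      ≡⟨ cong (N ^ ℓ *_) (W-δ M x (β x) (χ (xs , β)) (χ-update xs β x x∉xs)) ⟩
    N ^ ℓ * (weight (β x) * W M (χ (xs , β)))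
      ≤⟨ *-monoʳ-≤ (N ^ ℓ) (*-monoˡ-≤ _ (β≤w x)) ⟩
    N ^ ℓ * (w * W M (χ (xs , β)))         ≡⟨ shuffle′ (N ^ ℓ) w _ ⟩
    w * (N ^ ℓ * W M (χ (xs , β)))         ≤⟨ *-monoʳ-≤ w (W-χ w xs β β≤w uxs) ⟩
    w * (w ^ ℓ * N ^ M)                    ≡⟨ sym (*-assoc w (w ^ ℓ) (N ^ M)) ⟩
    w * w ^ ℓ * N ^ M                      ∎
    where
    open ≤-Reasoning
    ℓ = length xs
    shuffle : ∀ n p q → n * p * q ≡ p * (n * q)
    shuffle = solve-∀
    shuffle′ : ∀ p w q → p * (w * q) ≡ w * (p * q)
    shuffle′ = solve-∀

  -- Linearity of expectation. It serves twice: with `w = 1` for patterns, which prescribe only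
  -- `true`, and with `w = r` for pairs of sets, which prescribe both values.
  W-count : ∀ {M} w ℓ (ev : I → Event M) is → (∀ i j → weight (proj₂ (ev i) j) ≤ w) →
    N ^ ℓ * W M (count ev (filter (proper? ℓ ∘ ev) is)) ≤ length is * (w ^ ℓ * N ^ M)
  W-count {M = M} w ℓ ev is β≤w = begin
    N ^ ℓ * W M (count ev js)                     ≡⟨ cong (N ^ ℓ *_) (W-sum M (χ ∘ ev) js) ⟩
    N ^ ℓ * sum (map (λ j → W M (χ (ev j))) js)
      ≤⟨ sum-≤ _ (N ^ ℓ) (w ^ ℓ * N ^ M) (All.map bound (All.all-filter (proper? ℓ ∘ ev) is)) ⟩
    length js * (w ^ ℓ * N ^ M)                   ≤⟨ *-monoˡ-≤ _ (length-filter (proper? ℓ ∘ ev) is) ⟩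
    length is * (w ^ ℓ * N ^ M)                   ∎
    where
    open ≤-Reasoning
    js = filter (proper? ℓ ∘ ev) is
    bound : ∀ {i} → Proper ℓ (ev i) → N ^ ℓ * W M (χ (ev i)) ≤ w ^ ℓ * N ^ M
    bound {i} (u , refl) = W-χ w (proj₁ (ev i)) (proj₂ (ev i)) (β≤w i) u

-- Tournaments given by their backedges.

coloured : Vec Bool (n * n) → Fin n → Fin n → Set
coloured g x y = lookup g (combine x y) ≡ true

coloured? : ∀ (g : Vec Bool (n * n)) x y → Dec (coloured {n} g x y)
coloured? g x y = lookup g (combine x y) Bool.≟ true

module BackedgeTournament {n : ℕ} (g : Vec Bool (n * n)) (D : List (Fin n)) where

  open DecMembership (Fin._≟_ {n}) using () renaming (_∈?_ to _∈ˡ?_)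

  -- The vertices of `D` stay, so the order remains `n`; all edges at them point forward.
  Back : Fin n → Fin n → Set
  Back x y = coloured {n} g x y × x ∉ˡ D × y ∉ˡ D

  back? : ∀ x y → Dec (Back x y)
  back? x y = coloured? {n} g x y ×-dec ¬? (x ∈ˡ? D) ×-dec ¬? (y ∈ˡ? D)

  -- Of the entries of `g`, only those at `combine x y` with `x < y` are consulted.
  Arc : Fin n → Fin n → Set
  Arc u v = (u Fin.< v × ¬ Back u v) ⊎ (v Fin.< u × Back v u)

  arc-irrefl : ∀ u → ¬ Arc u u
  arc-irrefl u (inj₁ (u<u , _)) = Fin.<-irrefl refl u<u
  arc-irrefl u (inj₂ (u<u , _)) = Fin.<-irrefl refl u<u

  arc-exactly-one : ∀ u v → u ≢ v → (Arc u v × ¬ Arc v u) ⊎ (¬ Arc u v × Arc v u)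
  arc-exactly-one u v u≢v with Fin.<-cmp u v | back? u v | back? v u
  ... | tri≈ _ u≡v _   | _     | _     = contradiction u≡v u≢v
  ... | tri< u<v _ v≮u | yes b | _     =
    inj₂ ([ (λ p → proj₂ p b) , (λ p → v≮u (proj₁ p)) ]′ , inj₂ (u<v , b))
  ... | tri< u<v _ v≮u | no ¬b | _     =
    inj₁ (inj₁ (u<v , ¬b) , [ (λ p → v≮u (proj₁ p)) , (λ p → ¬b (proj₂ p)) ]′)
  ... | tri> u≮v _ v<u | _     | yes b =
    inj₁ (inj₂ (v<u , b) , [ (λ p → proj₂ p b) , (λ p → u≮v (proj₁ p)) ]′)
  ... | tri> u≮v _ v<u | _     | no ¬b =
    inj₂ ([ (λ p → u≮v (proj₁ p)) , (λ p → ¬b (proj₂ p)) ]′ , inj₁ (v<u , ¬b))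

  tournament : Tournament
  tournament = record
    { order = n ; Edge = Arc ; loopless = arc-irrefl ; exactly-one = arc-exactly-one }

-- Pure pairs as events.

coord : Fin n → Fin n → Fin (n * n)
coord a b = if does (a Fin.<? b) then combine a b else combine b a

coord-< : {a b : Fin n} → a Fin.< b → coord a b ≡ combine a b
coord-< {a = a} {b} a<b = cong (if_then combine a b else combine b a) (dec-true (a Fin.<? b) a<b)

coord-≮ : {a b : Fin n} → ¬ a Fin.< b → coord a b ≡ combine b a
coord-≮ {a = a} {b} a≮b = cong (if_then combine a b else combine b a) (dec-false (a Fin.<? b) a≮b)

-- If A is complete to B, then for x < y with one end in A and the other in B,
-- the edge between them is a backedge exactly when x lies in B.
prescribed : Subset n → Fin (n * n) → Bool
prescribed {n} B i = lookup B (quotient n i)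

crossing : Subset n → Subset n → List (Fin (n * n))
crossing A B = map (λ (a , b) → coord a b) (cartesianProduct (elements A) (elements B))

-- Truncation to `ℓ` coordinates gives all large pairs one common probability bound.
pairEvent : ℕ → Subset n × Subset n → Event (n * n)
pairEvent ℓ (A , B) = take ℓ (crossing A B) , prescribed B

prescribed-combine : ∀ (B : Subset n) x y → prescribed B (combine x y) ≡ lookup B x
prescribed-combine B x y = cong (lookup B ∘ proj₁) (Fin.remQuot-combine x y)

∉⇒lookup : {p : Subset n} {x : Fin n} → ¬ x ∈ p → lookup p x ≡ false
∉⇒lookup {p = p} {x} x∉p = Bool.¬-not (λ eq → x∉p (Vec.lookup⇒[]= x p eq))

-- If the two pairs are sorted in opposite ways, equal coordinates force `a ≡ b′`, a common element
-- of `A` and `B`.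
coord-injective : ∀ {A B : Subset n} → Empty (A ∩ B) → ∀ {a b a′ b′} →
  a ∈ A → b ∈ B → a′ ∈ A → b′ ∈ B → coord a b ≡ coord a′ b′ → (a , b) ≡ (a′ , b′)
coord-injective {A = A} {B} ∅ {a} {b} {a′} {b′} a∈ b∈ a′∈ b′∈ eq
  with does (a Fin.<? b) | does (a′ Fin.<? b′)
... | true  | true  with Fin.combine-injective a b a′ b′ eq
... | refl , refl = refl
coord-injective ∅ {a} {b} {a′} {b′} a∈ b∈ a′∈ b′∈ eq
    | false | false with Fin.combine-injective b a b′ a′ eq
... | refl , refl = refl
coord-injective ∅ {a} {b} {a′} {b′} a∈ b∈ a′∈ b′∈ eq
    | true  | false with Fin.combine-injective a b b′ a′ eq
... | refl , refl = contradiction (a , x∈p∩q⁺ (a∈ , b′∈)) ∅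
coord-injective ∅ {a} {b} {a′} {b′} a∈ b∈ a′∈ b′∈ eq
    | false | true  with Fin.combine-injective b a a′ b′ eq
... | refl , refl = contradiction (a , x∈p∩q⁺ (a∈ , b′∈)) ∅

crossing-all : ∀ {A B : Subset n} →
  All (λ (a , b) → a ∈ A × b ∈ B) (cartesianProduct (elements A) (elements B))
crossing-all {A = A} {B} = All.cartesianProduct⁺ (setoid _) (setoid _) (elements A) (elements B)
  (λ a∈ b∈ → All.lookup (elements⊆ A) a∈ , All.lookup (elements⊆ B) b∈)

pairEvent-proper : ∀ {A B : Subset n} ℓ → Empty (A ∩ B) → ℓ ≤ ∣ A ∣ * ∣ B ∣ →
  Proper ℓ (pairEvent ℓ (A , B))
pairEvent-proper {A = A} {B} ℓ ∅ ℓ≤ =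
    Unique.take⁺ ℓ (unique-map-on
      (λ (a∈ , b∈) (a′∈ , b′∈) → coord-injective ∅ a∈ b∈ a′∈ b′∈) crossing-all
      (Unique.cartesianProduct⁺ (elements-unique A) (elements-unique B)))
  , trans (length-take ℓ (crossing A B)) (m≤n⇒m⊓n≡m (subst (ℓ ≤_) (sym size) ℓ≤))
  where
  size : length (crossing A B) ≡ ∣ A ∣ * ∣ B ∣
  size = trans (length-map _ (cartesianProduct (elements A) (elements B)))
    (trans (length-cartesianProductWith _,_ (elements A) (elements B))
           (cong₂ _*_ (length-elements A) (length-elements B)))

module _ {n : ℕ} {g : Vec Bool (n * n)} {D : List (Fin n)} where

  open BackedgeTournament g D

  -- Outside `D` the tournament shows the colouring faithfully: a forward edge means uncoloured, and
  -- its smaller end lies in `A`, hence not in `B`; a backedge means coloured, and its smaller end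
  -- lies in `B`.
  coord-prescribed : ∀ {A B : Subset n} → Empty (A ∩ B) → ∀ {a b} → a ∈ A → b ∈ B →
    a ∉ˡ D → b ∉ˡ D → Arc a b → lookup g (coord a b) ≡ prescribed B (coord a b)
  coord-prescribed {A} {B} ∅ {a} {b} a∈ b∈ a∉D b∉D (inj₁ (a<b , ¬back))
    rewrite coord-< a<b | prescribed-combine B a b =
    trans (Bool.¬-not (λ eq → ¬back (eq , a∉D , b∉D)))
          (sym (∉⇒lookup (λ a∈B → ∅ (a , x∈p∩q⁺ (a∈ , a∈B)))))
  coord-prescribed {A} {B} ∅ {a} {b} a∈ b∈ a∉D b∉D (inj₂ (b<a , eq , _))
    rewrite coord-≮ (Fin.<-asym b<a) | prescribed-combine B b a =
    trans eq (sym (Vec.[]=⇒lookup b∈))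

  purePair-occurs : ∀ ℓ (P : PurePair tournament) → let open PurePair P in
    Occurs (pairEvent ℓ (A ∖ D , B ∖ D)) g
  purePair-occurs ℓ P = All.take⁺ ℓ (All.map⁺ (All.map occurs crossing-all))
    where
    open PurePair P
    disjoint′ : Empty ((A ∖ D) ∩ (B ∖ D))
    disjoint′ = ∖-disjoint D disjoint
    occurs : ∀ {(a , b) : Fin n × Fin n} → a ∈ A ∖ D × b ∈ B ∖ D →
      lookup g (coord a b) ≡ prescribed (B ∖ D) (coord a b)
    occurs (a∈ , b∈) with ∈-∖⁻ A D a∈ | ∈-∖⁻ B D b∈
    ... | a∈A , a∉D | b∈B , b∉D = coord-prescribed disjoint′ a∈ b∈ a∉D b∉D (complete a∈A b∈B)

-- Triangles of `P₇` and patterns of seven backedges.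

next : Fin 7 → Fin 7
next = lookup (Vec.tail (Vec.allFin 7) Vec.∷ʳ zero)

-- The 21 edges of P₇ split into the seven cyclic triangles i → i + 1 → i + 3 → i.
side : Fin 7 → Fin 3 → Fin 7 × Fin 7
side i zero             = i , next i
side i (suc zero)       = next i , next (next (next i))
side i (suc (suc zero)) = next (next (next i)) , i

-- Opaque, lest the decision procedures be unfolded in every later proof.
opaque

  side-edge : ∀ i j → PaleyEdge (proj₁ (side i j)) (proj₂ (side i j))
  side-edge = from-yes (Fin.all? λ i → Fin.all? λ j → paleyEdge? (proj₁ (side i j)) (proj₂ (side i j)))

  -- Distinct triangles share no edge, so backedges chosen from the seven triangles are seven
  -- distinct edges.
  side-injective : ∀ i i′ j j′ → side i j ≡ side i′ j′ → i ≡ i′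
  side-injective = from-yes (Fin.all? λ i → Fin.all? λ i′ → Fin.all? λ j → Fin.all? λ j′ →
    ≡-dec Fin._≟_ Fin._≟_ (side i j) (side i′ j′) →-dec (i Fin.≟ i′))

  paley-adjacent : ∀ u v → u ≢ v → PaleyEdge u v ⊎ PaleyEdge v u
  paley-adjacent = from-yes (Fin.all? λ u → Fin.all? λ v →
    ¬? (u Fin.≟ v) →-dec (paleyEdge? u v ⊎-dec paleyEdge? v u))

-- A choice of one side of each triangle, together with a placement of the vertices.
Pattern : ℕ → Set
Pattern n = Vec (Fin 3) 7 × Vec (Fin n) 7

tail head : Pattern n → Fin 7 → Fin n
tail (c , v) i = lookup v (proj₁ (side i (lookup c i)))
head (c , v) i = lookup v (proj₂ (side i (lookup c i)))

-- The head comes first, since a backedge runs from its larger end to its smaller one and `Arc`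
-- reads colours smaller end first. Patterns with a head above its tail are counted too, which only
-- enlarges the count.
patternEvent : Pattern n → Event (n * n)
patternEvent τ = tabulate (λ i → combine (head τ i) (tail τ i)) , λ _ → true

patternEvent-proper : (τ : Pattern n) →
  (∀ x y → lookup (proj₂ τ) x ≡ lookup (proj₂ τ) y → x ≡ y) → Proper 7 (patternEvent τ)
patternEvent-proper (c , v) inj = Unique.tabulate⁺ distinct , refl
  where
  distinct : ∀ {i i′} → combine (head (c , v) i) (tail (c , v) i)
                      ≡ combine (head (c , v) i′) (tail (c , v) i′) → i ≡ i′
  distinct {i} {i′} eq with Fin.combine-injective _ _ _ _ eq
  ... | h≡ , t≡ = side-injective i i′ (lookup c i) (lookup c i′)
                    (cong₂ _,_ (inj _ _ t≡) (inj _ _ h≡))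

-- Opaque, lest the type checker expand the 3 ^ 7 choices of sides.
opaque

  choices : ℕ
  choices = 3 ^ 7

  choices≢0 : NonZero choices
  choices≢0 = m^n≢0 3 7

  patterns : ∀ n → List (Pattern n)
  patterns n = cartesianProduct (vectors (allFin 3) 7) (vectors (allFin n) 7)

  ∈-patterns : (τ : Pattern n) → τ ∈ˡ patterns n
  ∈-patterns (c , v) = ∈-cartesianProduct⁺ (∈-vectors ∈-allFin c) (∈-vectors ∈-allFin v)

  length-patterns : ∀ n → length (patterns n) ≡ choices * n ^ 7
  length-patterns = size 3
    where
    size : ∀ m n → length (cartesianProduct (vectors (allFin m) 7) (vectors (allFin n) 7))
                   ≡ m ^ 7 * n ^ 7
    size m n = trans (length-vectors² (allFin m) (allFin n) 7)
      (cong₂ (λ a b → a ^ 7 * b ^ 7) (length-tabulate {n = m} (λ i → i))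
                                     (length-tabulate {n = n} (λ i → i)))

module _ {n : ℕ} {g : Vec Bool (n * n)} {D : List (Fin n)} where

  open BackedgeTournament g D

  -- A cyclic triangle cannot increase along all three of its sides.
  triangle-back : (ψ : Fin 7 → Fin n) → (∀ {u v} → PaleyEdge u v → Arc (ψ u) (ψ v)) →
    ∀ i → ∃ λ j → Back (ψ (proj₂ (side i j))) (ψ (proj₁ (side i j)))
  triangle-back ψ hom i
    with hom (side-edge i zero) | hom (side-edge i (suc zero)) | hom (side-edge i (suc (suc zero)))
  ... | inj₂ (_ , b) | _            | _            = zero , b
  ... | inj₁ _       | inj₂ (_ , b) | _            = suc zero , b
  ... | inj₁ _       | inj₁ _       | inj₂ (_ , b) = suc (suc zero) , b
  ... | inj₁ (p , _) | inj₁ (q , _) | inj₁ (r , _) =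
    contradiction (Fin.<-trans (Fin.<-trans p q) r) (Fin.<-irrefl refl)

  -- The pattern takes one backedge from each triangle. These backedges survived the deletion, so
  -- their ends avoid `D`; this is what will contradict the choice of `D` as a hitting set.
  paley-copy : (ψ : Fin 7 → Fin n) → (∀ {u v} → PaleyEdge u v → Arc (ψ u) (ψ v)) →
    ∃ λ τ → Proper 7 (patternEvent τ) × Occurs (patternEvent τ) g × head τ zero ∉ˡ D
  paley-copy ψ hom =
      (c , v)
    , patternEvent-proper (c , v) (λ x y eq → ψ-injective x y
        (trans (sym (v-lookup x)) (trans eq (v-lookup y))))
    , All.tabulate⁺ (proj₁ ∘ back)
    , proj₁ (proj₂ (back zero))
    where
    c = Vec.tabulate (proj₁ ∘ triangle-back ψ hom)
    v = Vec.tabulate ψ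
    v-lookup : ∀ x → lookup v x ≡ ψ x
    v-lookup = Vec.lookup∘tabulate ψ
    back : ∀ i → Back (head (c , v) i) (tail (c , v) i)
    back i rewrite Vec.lookup∘tabulate (proj₁ ∘ triangle-back ψ hom) i
                 | v-lookup (proj₁ (side i (proj₁ (triangle-back ψ hom i))))
                 | v-lookup (proj₂ (side i (proj₁ (triangle-back ψ hom i))))
      = proj₂ (triangle-back ψ hom i)
    -- Identifying two adjacent vertices would create a loop.
    ψ-injective : ∀ x y → ψ x ≡ ψ y → x ≡ y
    ψ-injective x y eq with x Fin.≟ y
    ... | yes x≡y = x≡y
    ... | no  x≢y with paley-adjacent x y x≢y
    ...   | inj₁ e = contradiction (subst (Arc (ψ x)) (sym eq) (hom e)) (arc-irrefl (ψ x))
    ...   | inj₂ e = contradiction (subst (Arc (ψ y)) eq (hom e)) (arc-irrefl (ψ y))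

-- Destroying the copies of `P₇`.

properPatterns : ∀ n → List (Pattern n)
properPatterns n = filter (proper? 7 ∘ patternEvent) (patterns n)

-- Deleting the backedges at these vertices destroys every copy of P₇ and creates
-- none, since a copy in what remains needs backedges that all survive.
hitting : Vec Bool (n * n) → List (Fin n)
hitting {n} g =
  map (λ τ → head τ zero) (filter (λ τ → occurs? (patternEvent τ) g) (properPatterns n))

sparsified : Vec Bool (n * n) → Tournament
sparsified {n} g = BackedgeTournament.tournament {n} g (hitting {n} g)

∈-hitting : (g : Vec Bool (n * n)) (τ : Pattern n) →
  Proper 7 (patternEvent τ) → Occurs (patternEvent τ) g → head τ zero ∈ˡ hitting {n} g
∈-hitting g τ proper occurs = ∈-map⁺ (λ τ → head τ zero)
  (∈-filter⁺ (λ τ → occurs? (patternEvent τ) g)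
    (∈-filter⁺ (proper? 7 ∘ patternEvent) (∈-patterns τ) proper) occurs)

sparsified-P₇-free : (g : Vec Bool (n * n)) → P₇ -Free sparsified {n} g
sparsified-P₇-free {n} g S (φ , hom) =
  let τ , proper , occurs , h∉D = paley-copy {n = n} {g = g} {D = hitting {n} g}
        (λ u → proj₁ (Inverse.to φ u)) (λ {u} {v} → Equivalence.to (hom u v))
  in h∉D (∈-hitting {n} g τ proper occurs)

length-hitting : (g : Vec Bool (n * n)) →
  length (hitting {n} g) ≤ count patternEvent (properPatterns n) g
length-hitting {n} g = ≤-trans (≤-reflexive (length-map (λ τ → head τ zero)
    (filter (λ τ → occurs? (patternEvent τ) g) (properPatterns n))))
  (occurring≤count patternEvent (properPatterns n) g)

-- Large pure pairs in the union over all pairs of subsets.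

subsetPairs : ∀ n → List (Subset n × Subset n)
subsetPairs n = cartesianProduct subsets subsets
  where subsets = vectors (true ∷ false ∷ []) n

∈-subsetPairs : (AB : Subset n × Subset n) → AB ∈ˡ subsetPairs n
∈-subsetPairs (A , B) = ∈-cartesianProduct⁺ (∈-vectors every A) (∈-vectors every B)
  where
  every : ∀ b → b ∈ˡ true ∷ false ∷ []
  every true  = here refl
  every false = there (here refl)

length-subsetPairs : ∀ n → length (subsetPairs n) ≡ 2 ^ n * 2 ^ n
length-subsetPairs n = length-vectors² _ _ n

properPairs : ∀ n → ℕ → List (Subset n × Subset n)
properPairs n ℓ = filter (proper? ℓ ∘ pairEvent ℓ) (subsetPairs n)

-- Although the hitting set depends on `g`, the shrunken pair is one of the fixed list of pairs of
-- subsets and its event concerns `g` alone, so the union bound still covers it.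
largePair⇒count : ∀ ℓ (g : Vec Bool (n * n)) (P : PurePair (sparsified {n} g)) →
  let open PurePair P in ℓ ≤ ∣ A ∖ hitting {n} g ∣ * ∣ B ∖ hitting {n} g ∣ →
  1 ≤ count (pairEvent ℓ) (properPairs n ℓ) g
largePair⇒count {n} ℓ g P ℓ≤ = ≤-trans
  (≤-reflexive (sym (occurs⇒χ≡1 (pairEvent ℓ AB) g (purePair-occurs {n = n} {g = g} {D = D} ℓ P))))
  (∈⇒≤sum (λ AB → χ (pairEvent ℓ AB) g) (∈-filter⁺ (proper? ℓ ∘ pairEvent ℓ) (∈-subsetPairs AB)
    (pairEvent-proper ℓ disjoint′ ℓ≤)))
  where
  open PurePair P
  D = hitting {n} g
  AB = A ∖ D , B ∖ D
  disjoint′ : Empty ((A ∖ D) ∩ (B ∖ D))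
  disjoint′ = ∖-disjoint D disjoint

-- Exponential estimates.

^-distribʳ-* : ∀ a b k → (a * b) ^ k ≡ a ^ k * b ^ k
^-distribʳ-* a b zero    = refl
^-distribʳ-* a b (suc k) = trans (cong (a * b *_) (^-distribʳ-* a b k)) (shuffle a b _ _)
  where
  shuffle : ∀ a b x y → a * b * (x * y) ≡ a * x * (b * y)
  shuffle = solve-∀

-- Bernoulli's inequality `1 + k / r ≤ (1 + 1 / r) ^ k`, cleared of denominators.
bernoulli : ∀ r k → r ^ k * (r + k) ≤ suc r ^ k * r
bernoulli r zero    = ≤-reflexive (cong (_+ 0) (+-identityʳ r))
bernoulli r (suc k) = begin
  r * r ^ k * (r + suc k)              ≤⟨ m≤m+n _ (r ^ k * k) ⟩
  r * r ^ k * (r + suc k) + r ^ k * k  ≡⟨ shuffle r k (r ^ k) ⟩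
  suc r * (r ^ k * (r + k))            ≤⟨ *-monoʳ-≤ (suc r) (bernoulli r k) ⟩
  suc r * (suc r ^ k * r)              ≡⟨ sym (*-assoc (suc r) (suc r ^ k) r) ⟩
  suc r * suc r ^ k * r                ∎
  where
  open ≤-Reasoning
  shuffle : ∀ r k x → r * x * (r + (1 + k)) + x * k ≡ (1 + r) * (x * (r + k))
  shuffle = solve-∀

-- This is `(1 - 1 / N) ^ N ≤ 1 / 2` for `N = suc r`, from Bernoulli's inequality with exponent `N`.
halving : ∀ r → .{{_ : NonZero r}} → 2 * r ^ suc r ≤ suc r ^ suc r
halving r = *-cancelʳ-≤ _ _ r (begin
  2 * r ^ suc r * r              ≤⟨ m≤m+n _ (r ^ suc r) ⟩
  2 * r ^ suc r * r + r ^ suc r  ≡⟨ shuffle r (r ^ suc r) ⟩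
  r ^ suc r * (r + suc r)        ≤⟨ bernoulli r (suc r) ⟩
  suc r ^ suc r * r              ∎)
  where
  open ≤-Reasoning
  shuffle : ∀ r x → 2 * x * r + x ≡ x * (r + (1 + r))
  shuffle = solve-∀

halving-power : ∀ r s → .{{_ : NonZero r}} → 2 ^ s * r ^ (suc r * s) ≤ suc r ^ (suc r * s)
halving-power r s = begin
  2 ^ s * r ^ (suc r * s)      ≡⟨ cong (2 ^ s *_) (sym (^-*-assoc r (suc r) s)) ⟩
  2 ^ s * (r ^ suc r) ^ s      ≡⟨ sym (^-distribʳ-* 2 (r ^ suc r) s) ⟩
  (2 * r ^ suc r) ^ s          ≤⟨ ^-monoˡ-≤ s (halving r) ⟩
  (suc r ^ suc r) ^ s          ≡⟨ ^-*-assoc (suc r) (suc r) s ⟩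
  suc r ^ (suc r * s)          ∎
  where open ≤-Reasoning

-- By halving, each pair has probability at most `2 ^ (- s)`. There are `2 ^ (n + n)` pairs; one
-- further factor of two brings the total below one half, and another makes the inequality strict.
union-bound : ∀ r s n ℓ → .{{_ : NonZero r}} → ℓ ≡ suc r * s → 2 + (n + n) ≤ s →
  2 * (2 ^ n * 2 ^ n * r ^ ℓ) < suc r ^ ℓ
union-bound r s n ℓ refl 2+2n≤s = begin-strict
  x                          <⟨ m<m*n x 2 {{>-nonZero x>0}} (s≤s (s≤s z≤n)) ⟩
  x * 2                      ≡⟨ shuffle (2 ^ n) (r ^ ℓ) ⟩
  2 * (2 * (2 ^ n * 2 ^ n)) * r ^ ℓ
    ≡⟨ cong (λ a → 2 * (2 * a) * r ^ ℓ) (sym (^-distribˡ-+-* 2 n n)) ⟩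
  2 ^ (2 + (n + n)) * r ^ ℓ  ≤⟨ *-monoˡ-≤ (r ^ ℓ) (^-monoʳ-≤ 2 2+2n≤s) ⟩
  2 ^ s * r ^ ℓ              ≤⟨ halving-power r s ⟩
  suc r ^ ℓ                  ∎
  where
  open ≤-Reasoning
  x = 2 * (2 ^ n * 2 ^ n * r ^ ℓ)
  x>0 : x > 0
  x>0 = *-mono-≤ {1} {2} {1} (s≤s z≤n)
    (*-mono-≤ {1} {2 ^ n * 2 ^ n} {1} (*-mono-≤ {1} {2 ^ n} {1} (m^n>0 2 n) (m^n>0 2 n)) (m^n>0 r ℓ))
  shuffle : ∀ t u → 2 * (t * t * u) * 2 ≡ 2 * (2 * (t * t)) * u
  shuffle = solve-∀

-- First moments.

module _ (r : ℕ) .{{_ : NonZero r}} where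

  open Weighted r

  -- The `n ^ 7` placements cancel against the probability `N ^ (- 7)` up to `d ^ 7`. Hence `K`
  -- depends on `d` only, and `N` may be chosen after it.
  W-patterns : ∀ n d K → n ≡ d * N → K ≡ choices * d ^ 7 →
    W (n * n) (count patternEvent (properPatterns n)) ≤ K * N ^ (n * n)
  W-patterns n d K n≡dN refl = *-cancelˡ-≤ (N ^ 7) {{m^n≢0 N 7}} (begin
    N ^ 7 * W (n * n) (count patternEvent (properPatterns n))
      ≤⟨ W-count 1 7 patternEvent (patterns n) (λ _ _ → ≤-refl) ⟩
    length (patterns n) * (1 ^ 7 * T)   ≡⟨ cong₂ _*_ (length-patterns n) (+-identityʳ T) ⟩
    choices * n ^ 7 * T                   ≡⟨ cong (λ a → choices * a * T)
                                             (trans (cong (_^ 7) n≡dN) (^-distribʳ-* d N 7)) ⟩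
    choices * (d ^ 7 * N ^ 7) * T         ≡⟨ shuffle choices (d ^ 7) (N ^ 7) T ⟩
    N ^ 7 * (choices * d ^ 7 * T)         ∎)
    where
    open ≤-Reasoning
    T = N ^ (n * n)
    shuffle : ∀ a b c t → a * (b * c) * t ≡ c * (a * b * t)
    shuffle = solve-∀

  W-pairs : ∀ n ℓ → 2 * (2 ^ n * 2 ^ n * r ^ ℓ) < N ^ ℓ →
    2 * W (n * n) (count (pairEvent ℓ) (properPairs n ℓ)) < N ^ (n * n)
  W-pairs n ℓ small = *-cancelˡ-< (N ^ ℓ) _ _ (begin-strict
    N ^ ℓ * (2 * V)                                    ≡⟨ shuffle (N ^ ℓ) V ⟩
    2 * (N ^ ℓ * V)
      ≤⟨ *-monoʳ-≤ 2 (W-count r ℓ (pairEvent ℓ) (subsetPairs n) (λ (A , B) i → weight≤r (prescribed B i))) ⟩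
    2 * (length (subsetPairs n) * (r ^ ℓ * T))
      ≡⟨ cong (λ a → 2 * (a * (r ^ ℓ * T))) (length-subsetPairs n) ⟩
    2 * (2 ^ n * 2 ^ n * (r ^ ℓ * T))                  ≡⟨ shuffle′ (2 ^ n * 2 ^ n) (r ^ ℓ) T ⟩
    2 * (2 ^ n * 2 ^ n * r ^ ℓ) * T                    <⟨ *-monoˡ-< T {{m^n≢0 N (n * n)}} small ⟩
    N ^ ℓ * T                                          ∎)
    where
    open ≤-Reasoning
    T = N ^ (n * n)
    V = W (n * n) (count (pairEvent ℓ) (properPairs n ℓ))
    weight≤r : ∀ b → weight b ≤ r
    weight≤r true  = >-nonZero⁻¹ r
    weight≤r false = ≤-refl
    shuffle : ∀ a b → a * (2 * b) ≡ 2 * (a * b)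
    shuffle = solve-∀
    shuffle′ : ∀ a b t → 2 * (a * (b * t)) ≡ 2 * (a * b) * t
    shuffle′ = solve-∀

  -- One sum handles both requirements: `2 * K * Y + X` has mean below `2 * K`, and a value below
  -- `2 * K` means `Y g = 0` and `X g < 2 * K` at once.
  first-moment : ∀ M K X Y → .{{_ : NonZero K}} → W M X ≤ K * N ^ M → 2 * W M Y < N ^ M →
    ¬ (∀ g → 2 * K ≤ 2 * K * Y g + X g)
  first-moment M K X Y WX≤ WY< all-bad = <-irrefl refl (begin-strict
    K * N ^ M + K * N ^ M            ≡⟨ shuffle K (N ^ M) ⟩
    N ^ M * (2 * K)                  ≡⟨ sym (W-const M (2 * K)) ⟩
    W M (λ _ → 2 * K)                ≤⟨ W-mono M all-bad ⟩
    W M (λ g → 2 * K * Y g + X g)    ≡⟨ W-+ M (λ g → 2 * K * Y g) X ⟩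
    W M (λ g → 2 * K * Y g) + W M X  ≡⟨ cong (_+ W M X) (W-* M (2 * K) Y) ⟩
    2 * K * W M Y + W M X            ≡⟨ cong (_+ W M X) (shuffle′ K (W M Y)) ⟩
    K * (2 * W M Y) + W M X          <⟨ +-mono-<-≤ (*-monoʳ-< K WY<) WX≤ ⟩
    K * N ^ M + K * N ^ M            ∎)
    where
    open ≤-Reasoning
    shuffle : ∀ k t → k * t + k * t ≡ t * (2 * k)
    shuffle = solve-∀
    shuffle′ : ∀ k y → 2 * k * y ≡ k * (2 * y)
    shuffle′ = solve-∀

-- Choice of parameters.

-- In a random graph on size = d N vertices with edge probability 1/N, where
-- N = 1 + r, the expected number of patterns is at most K, so that deleting
-- fewer than 2K = r < m vertices suffices.
record Parameters (k : ℕ) : Set where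
  field
    d K m r size : ℕ
    K≢0   : NonZero K
    K≡    : K ≡ choices * d ^ 7
    r≡    : r ≡ 2 * K
    r<m   : r < m
    size≡ : size ≡ d * suc r
    size≥ : k * (2 * m) ≤ size
    size>1 : 1 < size
    sparse : 2 * (2 ^ size * 2 ^ size * r ^ (m * m)) < suc r ^ (m * m)

-- With `m = q * N`, the exponent `m * m` is `N * s` for `s = q * m`. The union bound asks for `s`
-- at least `2 + 2 * size = 2 + 4 * k * m`, which dictates `q = 4 * k + 2`.
parameters : ∀ k q K r m → .{{NonZero k}} → q ≡ 4 * k + 2 → K ≡ choices * (2 * k * q) ^ 7 →
  r ≡ 2 * K → m ≡ q * suc r → Parameters k
parameters k q K r m q≡ K≡ r≡ m≡ = record
  { d = 2 * k * q ; K = K ; m = m ; r = r ; size = 2 * k * m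
  ; K≢0    = K≢0
  ; K≡     = K≡
  ; r≡     = r≡
  ; r<m    = r<m
  ; size≡  = trans (cong (2 * k *_) m≡) (sym (*-assoc (2 * k) q (suc r)))
  ; size≥  = ≤-reflexive (shuffle k m)
  ; size>1 = *-mono-≤ (*-monoʳ-≤ 2 (>-nonZero⁻¹ k)) m>0
  ; sparse = union-bound r (q * m) (2 * k * m) (m * m)
      {{subst NonZero (sym r≡) (m*n≢0 2 K {{_}} {{K≢0}})}} m²≡ 2+2size≤qm
  }
  where
  open ≤-Reasoning
  q>0 : 0 < q
  q>0 = ≤-trans (≤-trans (s≤s z≤n) (m≤n+m 2 (4 * k))) (≤-reflexive (sym q≡))
  K≢0 : NonZero K
  K≢0 = subst NonZero (sym K≡) (m*n≢0 choices _ {{choices≢0}} {{m^n≢0 (2 * k * q) 7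
    {{m*n≢0 (2 * k) q {{m*n≢0 2 k}} {{>-nonZero q>0}}}}}})
  r<m : r < m
  r<m = ≤-trans (m≤n*m (suc r) q {{>-nonZero q>0}}) (≤-reflexive (sym m≡))
  m>0 : 0 < m
  m>0 = ≤-trans (s≤s z≤n) r<m
  m²≡ : m * m ≡ suc r * (q * m)
  m²≡ = trans (cong (_* m) (trans m≡ (*-comm q (suc r)))) (*-assoc (suc r) q m)
  shuffle : ∀ k m → k * (2 * m) ≡ 2 * k * m
  shuffle = solve-∀
  shuffle′ : ∀ k m → 2 * m + (2 * k * m + 2 * k * m) ≡ (4 * k + 2) * m
  shuffle′ = solve-∀
  2+2size≤qm : 2 + (2 * k * m + 2 * k * m) ≤ q * m
  2+2size≤qm = begin
    2 + (2 * k * m + 2 * k * m)      ≤⟨ +-monoˡ-≤ _ (*-monoʳ-≤ 2 m>0) ⟩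
    2 * m + (2 * k * m + 2 * k * m)  ≡⟨ shuffle′ k m ⟩
    (4 * k + 2) * m                  ≡⟨ cong (_* m) (sym q≡) ⟩
    q * m                            ∎

-- No pure pairs of linear order.

∖-large : ∀ {m} D (p : Subset n) → length D ≤ m → 2 * m ≤ ∣ p ∣ → m ≤ ∣ p ∖ D ∣
∖-large {m = m} D p D≤m 2m≤ = +-cancelˡ-≤ m _ _ (begin
  m + m                  ≡⟨ cong (m +_) (sym (+-identityʳ m)) ⟩
  2 * m                  ≤⟨ 2m≤ ⟩
  ∣ p ∣                  ≤⟨ ∣∣-∖ p D ⟩
  length D + ∣ p ∖ D ∣   ≤⟨ +-monoˡ-≤ _ D≤m ⟩
  m + ∣ p ∖ D ∣          ∎)
  where open ≤-Reasoning

largePair⇒count-large : ∀ m (g : Vec Bool (n * n)) (P : PurePair (sparsified {n} g)) →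
  length (hitting {n} g) ≤ m → 2 * m ≤ PurePair.pairOrder P →
  1 ≤ count (pairEvent (m * m)) (properPairs n (m * m)) g
largePair⇒count-large {n} m g P D≤m 2m≤ = largePair⇒count {n} (m * m) g P
  (*-mono-≤ (∖-large {n} (hitting {n} g) A D≤m (≤-trans 2m≤ (m⊓n≤m ∣ A ∣ ∣ B ∣)))
            (∖-large {n} (hitting {n} g) B D≤m (≤-trans 2m≤ (m⊓n≤n ∣ A ∣ ∣ B ∣))))
  where open PurePair P

no-linear-pairs : ∀ k → .{{NonZero k}} →
  ¬ (∀ G → P₇ -Free G → 1 < order G → Σ[ P ∈ PurePair G ] order G ≤ k * PurePair.pairOrder P)
no-linear-pairs k eh = contradict (parameters k _ _ _ _ refl refl refl refl)
  where
  contradict : Parameters k → ⊥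
  contradict par = first-moment r {{r≢0}} (size * size) K Xs Ys {{K≢0}}
      (W-patterns r {{r≢0}} size d K size≡ K≡) (W-pairs r {{r≢0}} size (m * m) sparse)
      (λ g → subst (λ t → t ≤ t * Ys g + Xs g) r≡ (all-bad g))
    where
    open Parameters par
    r≢0 : NonZero r
    r≢0 = subst NonZero (sym r≡) (m*n≢0 2 K {{_}} {{K≢0}})
    Xs Ys : Vec Bool (size * size) → ℕ
    Xs = count patternEvent (properPatterns size)
    Ys = count (pairEvent (m * m)) (properPairs size (m * m))
    all-bad : ∀ g → r ≤ r * Ys g + Xs g
    -- Either `g` has at least `r` occurring patterns, or fewer than `m` vertices are hit; then the
    -- assumed pure pair of order at least `2 * m` keeps `m` vertices on each side and is counted by
    -- `Ys`.
    all-bad g = [ (λ r≤ → ≤-trans r≤ (m≤n+m (Xs g) (r * Ys g))) , few ]′ (≤-<-connex r (Xs g))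
      where
      few : Xs g < r → r ≤ r * Ys g + Xs g
      few Xs<r =
        let P , le = eh (sparsified {size} g) (sparsified-P₇-free {size} g) size>1
            Ys≥1 = largePair⇒count-large {size} m g P
              (≤-trans (length-hitting {size} g) (≤-trans (<⇒≤ Xs<r) (<⇒≤ r<m)))
              (*-cancelˡ-≤ k (≤-trans size≥ le))
        in ≤-trans (m≤m*n r (Ys g) {{>-nonZero Ys≥1}}) (m≤m+n (r * Ys g) (Xs g))

-- From rational to natural constants.

denominator-bound : ∀ c → 0ℚ ℚ.< c →
  ∀ n p → c ℚ.* fromℕ n ℚ.≤ fromℕ p → n ≤ ℚ.↧ₙ c * p
denominator-bound (ℚ.mkℚ ℤ.-[1+ a ] b _)   (ℚ.*<* ())
denominator-bound (ℚ.mkℚ (ℤ.+ zero) b _)   (ℚ.*<* (ℤ.+<+ ()))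
-- A positive numerator is at least one, so `c` is at least the reciprocal of its denominator.
denominator-bound c@(ℚ.mkℚ (ℤ.+ suc a) b _) _ n p cn≤p = begin
  n                  ≤⟨ m≤m+n n (a * n) ⟩
  suc a * n          ≡⟨ sym (*-identityʳ (suc a * n)) ⟩
  suc a * n * 1      ≤⟨ ℤ.drop‿+≤+ (subst₂ ℤ._≤_
                          (trans (cong (ℤ._* ℤ.+ 1) (sym (ℤ.pos-* (suc a) n))) (sym (ℤ.pos-* (suc a * n) 1)))
                          (sym (ℤ.pos-* p (suc b * 1)))
                          (ℚᵘ.drop-*≤* bound)) ⟩
  p * (suc b * 1)    ≡⟨ trans (cong (p *_) (*-identityʳ (suc b))) (*-comm p (suc b)) ⟩
  suc b * p          ∎
  where
  open ≤-Reasoning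
  -- Among unnormalised rationals the inequality is a plain cross-multiplication, free of common
  -- divisors.
  bound : ℚ.toℚᵘ c ℚᵘ.* ℚᵘ.mkℚᵘ (ℤ.+ n) 0 ℚᵘ.≤ ℚᵘ.mkℚᵘ (ℤ.+ p) 0
  bound = ℚᵘ.≤-respʳ-≃ (ℚ.toℚᵘ-fromℚᵘ (ℚᵘ.mkℚᵘ (ℤ.+ p) 0))
    (ℚᵘ.≤-respˡ-≃ (ℚᵘ.≃-trans (ℚ.toℚᵘ-homo-* c (fromℕ n))
                     (ℚᵘ.*-congˡ {ℚ.toℚᵘ c} (ℚ.toℚᵘ-fromℚᵘ (ℚᵘ.mkℚᵘ (ℤ.+ n) 0))))
      (ℚ.toℚᵘ-mono-≤ cn≤p))

mainTheorem4 : ¬ StrongEH P₇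
mainTheorem4 (c , c>0 , eh) = no-linear-pairs (ℚ.↧ₙ c) linear
  where
  linear : ∀ G → P₇ -Free G → 1 < order G →
    Σ[ P ∈ PurePair G ] order G ≤ ℚ.↧ₙ c * PurePair.pairOrder P
  linear G free 1<n with eh G free 1<n
  ... | P , le = P , denominator-bound c c>0 (order G) (PurePair.pairOrder P) le
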